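{- Let $m,n\in\mathbb{N}$, $0\le a\le n$, $0\le b\le m$ be integers. Then the dual (with respect to $m,n$) of $V_{a,b}\cap R_{n,m}$ is $R_{n-a,m-b}$. Consequently, for the family $\mathcal{F}=\{S_{a,b}\}$ consisting of a single double star, $$\mathrm{ex}(m,n,\mathcal{F})=mn-\gamma(R_{n-a,m-b},m,n),$$ where, for $a\le n-1$ and $b\le m-1$, $$\gamma(R_{n-a,m-b},m,n)=\min_{\substack{m-b\le x\le m\\ n-a\le y\le n}}\bigl((m-x)(n-y)+\max((n-a)x,(m-b)y)\bigr)$$ with $x,y$ ranging over integers.
   Context: $\mathbb{Z}_+=\{0,1,2,\dots\}$, $\mathbb{N}=\{1,2,\dots\}$, $[0,c]=\{0,\dots,c\}$, $R_{a,b}=[0,a-1]\times[0,b-1]$ (empty if $a=0$ or $b=0$). A zero-set (or Young diagram) is a downward-closed subset of $\mathbb{Z}_+^2$. For integers $a,b\ge0$, $V_{a,b}=\mathbb{Z}_+^2\setminus\{(x,y)\colon x\ge a,\ y\ge b\}$. Young domination: the graph $K_m\Box K_n$ is represented on the vertex set $R_{n,m}=[0,n-1]\times[0,m-1]$, two vertices being adjacent iff they differ in exactly one coordinate. For $v=(j,i)\in R_{n,m}$, $\mathcal{N}^r(v)$ is the set of all $(j',i)\in R_{n,m}$ with $j'\ne j$ and $\mathcal{N}^c(v)$ the set of all $(j,i')\in R_{n,m}$ with $i'\neq i$. For a zero-set $\mathcal{Z}$, $\mathcal{T}(A)=A\cup\{v\in R_{n,m}\setminus A\colon (|\mathcal{N}^r(v)\cap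 A|,|\mathcal{N}^c(v)\cap A|)\notin\mathcal{Z}\}$ and $\gamma(\mathcal{Z},m,n)=\min\{|A|\colon A\subseteq R_{n,m},\ \mathcal{T}(A)=R_{n,m}\}$. Duality: a convex corner of a Young diagram $\mathcal{Y}$ is a maximal point of $\mathcal{Y}$ in the coordinatewise order; a concave corner is a minimal point of $\mathbb{Z}_+^2\setminus\mathcal{Y}$; $\mathcal{I}_{\mathcal{Y}}$ is the set of concave corners. For a Young diagram $\mathcal{Y}\subseteq R_{n,m}$, its dual is the unique Young diagram $\check{\mathcal{Y}}\subseteq R_{n,m}$ whose set of convex corners is $\{(n-a-1,m-b-1)\colon (a,b)\in\mathcal{I}_{\mathcal{Y}},\ 0\le a\le n-1,\ 0\le b\le m-1\}$. Double stars: for integers $p,q\ge0$, $S_{p,q}$ is obtained from disjoint $K_{1,p}$ and $K_{1,q}$ by adding an edge between the center $u$ of $K_{1,p}$ and the center $v$ of $K_{1,q}$ (so $u$ has degree $p+1$ and $v$ degree $q+1$); it is equipped with the bipartition $(X_{p,q},Y_{p,q})$ with $u\in X_{p,q}$, $v\in Y_{p,q}$. For a family $\mathcal{F}$ of double stars, $\mathrm{ex}(m,n,\mathcal{F})$ is the maximum number of edges in a bipartite graph with bipartition $(X,Y)$, $|X|=m$, $|Y|=n$, that contains no $S_{p,q}\in\mathcal{F}$ as a (not necessarily induced) subgraph respecting the bipartitions (with $X_{p,q}$ inside $X$ and $Y_{p,q}$ inside $Y$). -}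

module Defs where

open import Level using (0ℓ)
open import Data.Bool.Properties using () renaming (_≟_ to _≟ᵇ_)
open import Data.Fin using (Fin; zero; suc; combine; remQuot; funToFin; finToFun)
open import Data.Fin.Properties
  using (_≟_; any?; all?; finToFun-funToFin; injective⇒≤)
import Data.Fin.Subset as Sub
open Sub using (Subset; ∣_∣; ⊤; ⊥)
open import Data.Fin.Subset.Properties
  using (anySubset?; ∉⊥; ∣p∣≤n; ∪-zeroˡ) renaming (_∈?_ to _∈ˢ?_)
open import Data.Nat
  using (ℕ; zero; suc; _*_; _+_; _∸_; _^_; _≤_; _<_)
open import Data.Nat.Properties as ℕₚ
  using (≤-trans; ≤-<-trans; ≮⇒≥; ≤-pred; ≤∧≢⇒<; _≤?_; _<?_; allUpTo?)
open import Data.Product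
  using (_×_; _,_; ∃; ∃₂; ∃-syntax; proj₁; proj₂; uncurry)
open import Data.Product.Properties using () renaming (≡-dec to ×-≡-dec)
open import Data.Product.Relation.Binary.Pointwise.NonDependent using (Pointwise)
open import Data.Vec using (tabulate)
open import Data.Vec.Properties using () renaming (≡-dec to vec-≡-dec)
open import Function using (_∘_)
open import Function.Definitions using (Injective)
open import Relation.Binary using (Rel)
open import Relation.Binary.PropositionalEquality
  using (_≡_; _≗_; refl; sym; trans; subst; subst₂)
open import Relation.Nullary
  using (¬_; Dec; yes; no; does; ¬?; _×-dec_; _→-dec_)
open import Relation.Nullary.Decidable using (map′)
open import Relation.Unary
  using (Pred; Decidable; _∈_; _∉_; _⊆_; _∩_; _≐_; ｛_｝)
open import Relation.Unary.Properties using (_∩?_)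

IsMinimum : Pred ℕ 0ℓ → Pred ℕ 0ℓ
IsMinimum P k = P k × (∀ {l} → P l → k ≤ l)

IsMaximum : Pred ℕ 0ℓ → Pred ℕ 0ℓ
IsMaximum P k = P k × (∀ {l} → P l → l ≤ k)

minimum : ∀ {P} → Decidable P → ∃ P → ∃ (IsMinimum P)
minimum {P} P? (w , Pw) = search w 0 (subst P (sym (ℕₚ.+-identityʳ w)) Pw) λ ()
  where
  -- `fuel` is the distance from `k` to a known element of `P`
  search : ∀ fuel k → P (fuel + k) → (∀ {l} → l < k → ¬ P l) → ∃ (IsMinimum P)
  search zero k Pk below = k , Pk , λ Pl → ≮⇒≥ λ l<k → below l<k Pl
  search (suc fuel) k Pf below with P? k
  ... | yes Pk = k , Pk , λ Pl → ≮⇒≥ λ l<k → below l<k Pl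
  ... | no ¬Pk = search fuel (suc k) (subst P (sym (ℕₚ.+-suc fuel k)) Pf) below′
    where
    below′ : ∀ {l} → l < suc k → ¬ P l
    below′ {l} l<1+k Pl with l ℕₚ.≟ k
    ... | yes refl = ¬Pk Pl
    ... | no l≢k = below (≤∧≢⇒< (≤-pred l<1+k) l≢k) Pl

maximum : ∀ {P} → Decidable P → ∃ P → (bound : ℕ) → (∀ {l} → P l → l ≤ bound) →
          ∃ (IsMaximum P)
maximum {P} P? (w , Pw) zero above = 0 , subst P (ℕₚ.n≤0⇒n≡0 (above Pw)) Pw , above
maximum {P} P? inhabited (suc b) above with P? (suc b)
... | yes Pb = suc b , Pb , above
... | no ¬Pb = maximum P? inhabited b
  λ Pl → ≤-pred (≤∧≢⇒< (above Pl) λ { refl → ¬Pb Pl })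

Point : Set
Point = ℕ × ℕ

_≼_ : Rel Point 0ℓ
_≼_ = Pointwise _≤_ _≤_

-- Membership is decidable so that γ below can be defined as a function.
record YoungDiagram : Set₁ where
  field
    points     : Pred Point 0ℓ
    points?    : Decidable points
    downClosed : ∀ {p q} → q ≼ p → p ∈ points → q ∈ points

open YoungDiagram public

infixr 7 _⊓_
_⊓_ : YoungDiagram → YoungDiagram → YoungDiagram
Y ⊓ Z = record
  { points     = points Y ∩ points Z
  ; points?    = points? Y ∩? points? Z
  ; downClosed = λ q≼p (p∈Y , p∈Z) → downClosed Y q≼p p∈Y , downClosed Z q≼p p∈Z
  }

R : ℕ → ℕ → YoungDiagram
R a b = record
  { points     = λ (x , y) → x < a × y < b
  ; points?    = λ (x , y) → (x <? a) ×-dec (y <? b)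
  ; downClosed = λ (x≤ , y≤) (x<a , y<b) → ≤-<-trans x≤ x<a , ≤-<-trans y≤ y<b
  }

V : ℕ → ℕ → YoungDiagram
V a b = record
  { points     = λ (x , y) → ¬ (a ≤ x × b ≤ y)
  ; points?    = λ (x , y) → ¬? ((a ≤? x) ×-dec (b ≤? y))
  ; downClosed = λ (x≤ , y≤) p∈V (a≤x , b≤y) → p∈V (≤-trans a≤x x≤ , ≤-trans b≤y y≤)
  }

ConvexCorner : YoungDiagram → Pred Point 0ℓ
ConvexCorner Y p = p ∈ points Y × (∀ {q} → q ∈ points Y → p ≼ q → q ≡ p)

ConcaveCorner : YoungDiagram → Pred Point 0ℓ
ConcaveCorner Y p = p ∉ points Y × (∀ {q} → q ∉ points Y → q ≼ p → q ≡ p)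

ReflectedConcaveCorner : ℕ → ℕ → YoungDiagram → Pred Point 0ℓ
ReflectedConcaveCorner m n Y p =
  ∃₂ λ a b → ConcaveCorner Y (a , b) × a < n × b < m ×
             p ≡ (n ∸ a ∸ 1 , m ∸ b ∸ 1)

DualityConditions : ℕ → ℕ → YoungDiagram → YoungDiagram → Set
DualityConditions m n Y D =
  points D ⊆ points (R n m) × ConvexCorner D ≐ ReflectedConcaveCorner m n Y

-- "D is the dual of Y": D is the one and only Young diagram satisfying the
-- conditions.
IsDual : ℕ → ℕ → YoungDiagram → YoungDiagram → Set₁
IsDual m n Y D =
  points Y ⊆ points (R n m) ×
  DualityConditions m n Y D ×
  (∀ E → DualityConditions m n Y E → points E ≐ points D)

-- A subset of Fin k × Fin l is a Subset (k * l), the pair (i , j) being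
-- numbered by `combine i j`.

⟦_⟧ : ∀ {k l} {P : Pred (Fin k × Fin l) 0ℓ} → Decidable P → Subset (k * l)
⟦_⟧ {k} {l} P? = tabulate λ i → does (P? (remQuot {k} l i))

_∈ᵖ_ : ∀ {k l} → Fin k × Fin l → Subset (k * l) → Set
(i , j) ∈ᵖ A = combine i j Sub.∈ A

_∈ᵖ?_ : ∀ {k l} (v : Fin k × Fin l) (A : Subset (k * l)) → Dec (v ∈ᵖ A)
(i , j) ∈ᵖ? A = combine i j ∈ˢ? A

-- The vertex set R_{n,m} of K_m □ K_n is Fin n × Fin m; a vertex is (j , i).

Nʳ : ∀ {n m} → Fin n × Fin m → Subset (n * m)
Nʳ (j , i) = ⟦ (λ (j′ , i′) → ¬? (j′ ≟ j) ×-dec (i′ ≟ i)) ⟧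

Nᶜ : ∀ {n m} → Fin n × Fin m → Subset (n * m)
Nᶜ (j , i) = ⟦ (λ (j′ , i′) → (j′ ≟ j) ×-dec ¬? (i′ ≟ i)) ⟧

counts : ∀ {n m} → Subset (n * m) → Fin n × Fin m → Point
counts A v = ∣ Nʳ v Sub.∩ A ∣ , ∣ Nᶜ v Sub.∩ A ∣

𝒯 : ∀ n m → YoungDiagram → Subset (n * m) → Subset (n * m)
𝒯 n m Z A =
  A Sub.∪ ⟦ (λ (v : Fin n × Fin m) → ¬? (v ∈ᵖ? A) ×-dec ¬? (points? Z (counts A v))) ⟧

DominatingSetSize : YoungDiagram → ℕ → ℕ → Pred ℕ 0ℓ
DominatingSetSize Z m n k = ∃[ A ] 𝒯 n m Z A ≡ ⊤ × ∣ A ∣ ≡ k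

γ-minimum : ∀ Z m n → ∃ (IsMinimum (DominatingSetSize Z m n))
γ-minimum Z m n = minimum
  (λ k → anySubset? λ A → vec-≡-dec _≟ᵇ_ (𝒯 n m Z A) ⊤ ×-dec (∣ A ∣ ℕₚ.≟ k))
  (_ , ⊤ , ∪-zeroˡ _ , refl)

γ : YoungDiagram → ℕ → ℕ → ℕ
γ Z m n = proj₁ (γ-minimum Z m n)

-- A bipartite graph with parts X = Fin m and Y = Fin n.
BipartiteGraph : ℕ → ℕ → Set
BipartiteGraph m n = Subset (m * n)

-- Edges of S_{p,q}.  The part of u is {u} ∪ {q leaves of v} and the part of v
-- is {v} ∪ {p leaves of u}, with u and v numbered zero.
data StarEdge {p q : ℕ} : Fin (suc q) → Fin (suc p) → Set where
  centres : StarEdge zero zero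
  u-leaf  : ∀ k → StarEdge zero (suc k)
  v-leaf  : ∀ k → StarEdge (suc k) zero

-- Not necessarily induced, and respecting the bipartitions.
record Contains (m n : ℕ) (G : BipartiteGraph m n) (p q : ℕ) : Set where
  field
    f           : Fin (suc q) → Fin m
    g           : Fin (suc p) → Fin n
    f-injective : Injective _≡_ _≡_ f
    g-injective : Injective _≡_ _≡_ g
    edges       : ∀ {x y} → StarEdge x y → (f x , g y) ∈ᵖ G

-- A set of double stars S_{p,q}, given by the pairs (p , q).
record Family : Set₁ where
  field
    members  : Pred (ℕ × ℕ) 0ℓ
    members? : Decidable members

open Family public

singleStar : ℕ → ℕ → Family
singleStar p q = record
  { members  = ｛ (p , q) ｝
  ; members? = ×-≡-dec ℕₚ._≟_ ℕₚ._≟_ (p , q)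
  }

Free : ∀ m n → Family → BipartiteGraph m n → Set
Free m n F G = ∀ {p q} → (p , q) ∈ members F → ¬ Contains m n G p q

starEdge? : ∀ {p q} (x : Fin (suc q)) (y : Fin (suc p)) → Dec (StarEdge x y)
starEdge? zero    zero    = yes centres
starEdge? zero    (suc k) = yes (u-leaf k)
starEdge? (suc k) zero    = yes (v-leaf k)
starEdge? (suc _) (suc _) = no λ ()

injective? : ∀ {k l} (f : Fin k → Fin l) → Dec (Injective _≡_ _≡_ f)
injective? f = map′ (λ h {x} {y} → h x y) (λ h x y → h {x} {y})
  (all? λ x → all? λ y → (f x ≟ f y) →-dec (x ≟ y))

injective-resp-≗ : ∀ {k l} {f g : Fin k → Fin l} → f ≗ g →
                   Injective _≡_ _≡_ f → Injective _≡_ _≡_ g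
injective-resp-≗ f≗g inj {x} {y} e = inj (trans (f≗g x) (trans e (sym (f≗g y))))

contains? : ∀ m n (G : BipartiteGraph m n) p q → Dec (Contains m n G p q)
contains? m n G p q = map′ to from (any? λ s → any? λ t →
    injective? (decodeˣ s) ×-dec injective? (decodeʸ t) ×-dec
    all? λ x → all? λ y → starEdge? x y →-dec ((decodeˣ s x , decodeʸ t y) ∈ᵖ? G))
  where
  decodeˣ : Fin (m ^ suc q) → Fin (suc q) → Fin m
  decodeˣ = finToFun

  decodeʸ : Fin (n ^ suc p) → Fin (suc p) → Fin n
  decodeʸ = finToFun

  Code : Fin (m ^ suc q) → Fin (n ^ suc p) → Set
  Code s t = Injective _≡_ _≡_ (decodeˣ s) × Injective _≡_ _≡_ (decodeʸ t) ×
             (∀ x y → StarEdge x y → (decodeˣ s x , decodeʸ t y) ∈ᵖ G)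

  to : ∃₂ Code → Contains m n G p q
  to (s , t , s-inj , t-inj , e) = record
    { f = decodeˣ s ; g = decodeʸ t
    ; f-injective = s-inj ; g-injective = t-inj ; edges = λ {x} {y} → e x y }

  from : Contains m n G p q → ∃₂ Code
  from c =
    funToFin f , funToFin g ,
    injective-resp-≗ (sym ∘ finToFun-funToFin f) f-injective ,
    injective-resp-≗ (sym ∘ finToFun-funToFin g) g-injective ,
    λ x y e → subst₂ (λ (i : Fin m) (j : Fin n) → (i , j) ∈ᵖ G)
      (sym (finToFun-funToFin f x)) (sym (finToFun-funToFin g y)) (edges e)
    where open Contains c

free? : ∀ m n (F : Family) (G : BipartiteGraph m n) → Dec (Free m n F G)
free? m n F G = map′
  (λ h {p} {q} p,q∈F c → h (injective⇒≤ (Contains.g-injective c))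
                   (injective⇒≤ (Contains.f-injective c)) p,q∈F c)
  (λ h {_} _ {_} _ → h)
  (allUpTo? (λ p → allUpTo? (λ q → members? F (p , q) →-dec ¬? (contains? m n G p q)) m) n)

FreeGraphSize : ℕ → ℕ → Family → Pred ℕ 0ℓ
FreeGraphSize m n F k = ∃[ G ] Free m n F G × ∣ G ∣ ≡ k

ex-maximum : ∀ m n F → ∃ (IsMaximum (FreeGraphSize m n F))
ex-maximum m n F = maximum
  (λ k → anySubset? λ G → free? m n F G ×-dec (∣ G ∣ ℕₚ.≟ k))
  (_ , ⊥ , (λ _ c → ∉⊥ (Contains.edges c centres)) , refl)
  (m * n)
  λ { (G , _ , refl) → ∣p∣≤n G }

ex : ℕ → ℕ → Family → ℕ
ex m n F = proj₁ (ex-maximum m n F)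

-- Write c = n - a and d = m - b.  A graph is free of S_{a,b} iff each of its edges
-- ends in a vertex of X of degree at most a or in a vertex of Y of degree at most
-- b; in the complement A this says that every cell outside A has at least c
-- elements of A in its row or at least d in its column, i.e. that A dominates for
-- the zero-set R_{c,d}.
--
-- Given such an A, let x be the number of rows with at least c elements and y the
-- number of columns with at least d.  The m - x by n - y block of the remaining
-- rows and columns lies in A, whence (m - x)(n - y) + max (c x, d y) ≤ |A|; if
-- x < d or y < c, these may be rounded up to d and c.  Conversely, fill such a
-- block and place max (c x, d y) elements cyclically in the opposite x by y block.

module Submission where

open import Level using (0ℓ)
import Algebra.Properties.Semiring.Sum
open import Data.Fin as Fin
  using (Fin; zero; suc; toℕ; fromℕ<; combine; remQuot; inject≤; punchIn; punchOut; _↑ˡ_; _↑ʳ_)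
open import Data.Fin.Properties as Finₚ using (_≟_; any?)
import Data.Fin.Subset as Sub
open Sub using (Subset; ∣_∣; ⊤)
open import Data.Fin.Subset.Properties
  using (∈⊤; x∈p∪q⁻; x∈p∪q⁺; ⊆-antisym; ⊆⊤; x∈p∩q⁺; x∈p∩q⁻) renaming (_∈?_ to _∈ˢ?_)
open import Data.Nat
  using (ℕ; zero; suc; _+_; _*_; _∸_; _≤_; _<_; _⊔_; z≤n; s≤s;
         NonZero; >-nonZero; >-nonZero⁻¹; ≢-nonZero)
open import Data.Nat.Properties as ℕₚ renaming (_≟_ to _≟ℕ_)
open import Data.Nat.DivMod
open import Data.Nat.Divisibility using (∣-refl)
open import Data.Nat.Tactic.RingSolver using (solve-∀)
open import Data.Product using (_×_; _,_; ∃; ∃₂; Σ-syntax; proj₁; proj₂)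
open import Data.Sum as Sum using (_⊎_; inj₁; inj₂)
open import Data.Vec using ([]; _∷_; lookup)
open import Data.Vec.Properties using (lookup⇒[]=; []=⇒lookup; lookup∘tabulate)
open import Data.Bool using (true; false; if_then_else_)
open import Function using (_∘_; flip; _⇔_; mk⇔; Equivalence)
open import Function.Definitions using (Injective)
open import Relation.Binary using (REL)
import Relation.Binary as Bin
open import Relation.Binary.PropositionalEquality
open import Relation.Nullary
open import Relation.Nullary.Decidable using (does-⇔; dec-true; decidable-stable)
open import Relation.Unary using (Pred; Decidable; _⊆_; _≐_)
open import Defs

module ∑ = Algebra.Properties.Semiring.Sum ℕₚ.+-*-semiring
open ∑ using (sum; sum-syntax; sum-cong-≗; ∑-distrib-+; ∑-comm; sum-remove;
              *-distribˡ-sum; *-distribʳ-sum)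

private variable
  m n k l c d x y : ℕ
  A B : Set

-- Indicator functions and finite sums.

𝟙 : Dec A → ℕ
𝟙 a? = if does a? then 1 else 0

𝟙-yes : (a? : Dec A) → A → 𝟙 a? ≡ 1
𝟙-yes a? a rewrite dec-true a? a = refl

𝟙-cong : A ⇔ B → (a? : Dec A) (b? : Dec B) → 𝟙 a? ≡ 𝟙 b?
𝟙-cong A⇔B a? b? = cong (if_then 1 else 0) (does-⇔ A⇔B a? b?)

sum-mono-≤ : ∀ {n} {f g : Fin n → ℕ} → (∀ i → f i ≤ g i) → sum f ≤ sum g
sum-mono-≤ {zero}  f≤g = z≤n
sum-mono-≤ {suc n} f≤g = +-mono-≤ (f≤g zero) (sum-mono-≤ (f≤g ∘ suc))

sum-zero : ∀ {n} {f : Fin n → ℕ} → (∀ i → f i ≡ 0) → sum f ≡ 0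
sum-zero {n} f≡0 = trans (sum-cong-≗ f≡0) (∑.sum-replicate-zero n)

sum-single : ∀ {n} (f : Fin n → ℕ) i → (∀ j → j ≢ i → f j ≡ 0) → sum f ≡ f i
sum-single {suc n} f i f≡0 = begin
  sum f                        ≡⟨ sum-remove {i = i} f ⟩
  f i + sum (f ∘ punchIn i)    ≡⟨ cong (f i +_) (sum-zero λ j → f≡0 _ (Finₚ.punchInᵢ≢i i j)) ⟩
  f i + 0                      ≡⟨ +-identityʳ _ ⟩
  f i                          ∎
  where open ≡-Reasoning

sum-↑ : ∀ k {l} (f : Fin (k + l) → ℕ) → sum f ≡ sum (f ∘ (_↑ˡ l)) + sum (f ∘ (k ↑ʳ_))
sum-↑ zero    f = refl
sum-↑ (suc k) f = trans (cong (f zero +_) (sum-↑ k (f ∘ suc))) (sym (+-assoc (f zero) _ _))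

sum-combine : ∀ k {l} (f : Fin (k * l) → ℕ) → sum f ≡ ∑[ i < k ] ∑[ j < l ] f (combine i j)
sum-combine zero        f = refl
sum-combine (suc k) {l} f =
  trans (sum-↑ l f) (cong (sum (f ∘ (_↑ˡ k * l)) +_) (sum-combine k (f ∘ (l ↑ʳ_))))

sum-product : (f : Fin k → ℕ) (g : Fin l → ℕ) → ∑[ i < k ] ∑[ j < l ] (f i * g j) ≡ sum f * sum g
sum-product f g = begin
  sum (λ i → sum λ j → f i * g j)  ≡⟨ sum-cong-≗ (λ i → sym (*-distribˡ-sum (f i) g)) ⟩
  sum (λ i → f i * sum g)          ≡⟨ *-distribʳ-sum (sum g) f ⟨
  sum f * sum g                    ∎
  where open ≡-Reasoning

-- Counting by injections.

count : {P : Pred (Fin n) 0ℓ} → Decidable P → ℕ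
count P? = sum λ i → 𝟙 (P? i)

count-cong : {P Q : Pred (Fin n) 0ℓ} (P? : Decidable P) (Q? : Decidable Q) →
             (∀ i → P i ⇔ Q i) → count P? ≡ count Q?
count-cong P? Q? P⇔Q = sum-cong-≗ λ i → 𝟙-cong (P⇔Q i) (P? i) (Q? i)

𝟙-¬ : (a? : Dec A) → 𝟙 a? + 𝟙 (¬? a?) ≡ 1
𝟙-¬ (yes _) = refl
𝟙-¬ (no _)  = refl

sum-one : ∀ n → ∑[ i < n ] 1 ≡ n
sum-one zero    = refl
sum-one (suc n) = cong suc (sum-one n)

count-¬ : {P : Pred (Fin n) 0ℓ} (P? : Decidable P) → count P? + count (¬? ∘ P?) ≡ n
count-¬ {n} P? = begin
  count P? + count (¬? ∘ P?)           ≡⟨ ∑-distrib-+ (𝟙 ∘ P?) (𝟙 ∘ ¬? ∘ P?) ⟨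
  sum (λ i → 𝟙 (P? i) + 𝟙 (¬? (P? i)))  ≡⟨ sum-cong-≗ (λ i → 𝟙-¬ (P? i)) ⟩
  ∑[ i < n ] 1                          ≡⟨ sum-one n ⟩
  n                                     ∎
  where open ≡-Reasoning

count-¬-∸ : {P : Pred (Fin n) 0ℓ} (P? : Decidable P) → count (¬? ∘ P?) ≡ n ∸ count P?
count-¬-∸ P? = trans (sym (m+n∸m≡n (count P?) _)) (cong (_∸ count P?) (count-¬ P?))

count≤n : {P : Pred (Fin n) 0ℓ} (P? : Decidable P) → count P? ≤ n
count≤n P? = subst (count P? ≤_) (count-¬ P?) (m≤m+n _ _)

count-remove : {P : Pred (Fin (suc n)) 0ℓ} (P? : Decidable P) {i : Fin (suc n)} → P i →
               count P? ≡ suc (count (P? ∘ punchIn i))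
count-remove P? {i} Pi =
  trans (sum-remove {i = i} (𝟙 ∘ P?)) (cong (_+ count (P? ∘ punchIn i)) (𝟙-yes (P? i) Pi))

-- A witness for `k ≤ count P?`: `enumerate` supplies one of full length, and `injection⇒≤count`
-- turns any of them back into an inequality.
InjectionInto : ℕ → Pred (Fin n) 0ℓ → Set
InjectionInto {n} k P = Σ[ e ∈ (Fin k → Fin n) ] Injective _≡_ _≡_ e × (∀ t → P (e t))

extend : {P : Pred (Fin (suc n)) 0ℓ} {i : Fin (suc n)} → P i →
         InjectionInto k (P ∘ punchIn i) → InjectionInto (suc k) P
extend {n} {k} {P} {i} Pi (e , e-inj , Pe) = e′ , inj , P-e′
  where
  e′ : Fin (suc k) → Fin (suc n)
  e′ zero    = i
  e′ (suc t) = punchIn i (e t)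

  inj : Injective _≡_ _≡_ e′
  inj {zero}  {zero}  _  = refl
  inj {zero}  {suc t} eq = contradiction (sym eq) (Finₚ.punchInᵢ≢i i (e t))
  inj {suc t} {zero}  eq = contradiction eq (Finₚ.punchInᵢ≢i i (e t))
  inj {suc t} {suc u} eq = cong suc (e-inj (Finₚ.punchIn-injective i _ _ eq))

  P-e′ : ∀ t → P (e′ t)
  P-e′ zero    = Pi
  P-e′ (suc t) = Pe t

enumerate : ∀ {n} {P : Pred (Fin n) 0ℓ} (P? : Decidable P) → InjectionInto (count P?) P
enumerate {zero}  P? = (λ ()) , (λ { {()} }) , λ ()
enumerate {suc n} {P} P? with P? zero
... | yes P0 = extend {P = P} P0 (enumerate (P? ∘ suc))
... | no _   = let e , e-inj , Pe = enumerate (P? ∘ suc) in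
               suc ∘ e , e-inj ∘ Finₚ.suc-injective , Pe

-- Induction on `k`: the image of `zero` is deleted from the codomain, and `punchOut` relabels the
-- remaining values without merging any of them.
injection⇒≤count : ∀ {n k} {P : Pred (Fin n) 0ℓ} (P? : Decidable P) →
                   InjectionInto k P → k ≤ count P?
injection⇒≤count         {k = zero}  P? _ = z≤n
injection⇒≤count {zero}  {k = suc k} P? (e , _) with () ← e zero
injection⇒≤count {suc n} {k = suc k} {P} P? (e , e-inj , Pe) =
  subst (suc k ≤_) (sym (count-remove P? (Pe zero))) (s≤s (injection⇒≤count (P? ∘ punchIn (e zero))
    ( (λ t → punchOut (e0≢ t))
    , (λ {t} {u} eq → Finₚ.suc-injective (e-inj (Finₚ.punchOut-injective (e0≢ t) (e0≢ u) eq)))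
    , (λ t → subst P (sym (Finₚ.punchIn-punchOut (e0≢ t))) (Pe (suc t))))))
  where
  e0≢ : ∀ t → e zero ≢ e (suc t)
  e0≢ t eq with () ← e-inj eq

-- The map `h` may inspect the proof of `P i`, as `row≤c` does to read off an offset. Composed with
-- an enumeration of `P` it is an injection between finite types.
count≤ : {P : Pred (Fin n) 0ℓ} (P? : Decidable P) (h : ∀ i → P i → Fin k) →
         (∀ {i j} (p : P i) (q : P j) → h i p ≡ h j q → i ≡ j) → count P? ≤ k
count≤ P? h h-inj = let e , e-inj , Pe = enumerate P? in
  Finₚ.injective⇒≤ {f = λ t → h (e t) (Pe t)} λ eq → e-inj (h-inj _ _ eq)

-- The value at `zero` is prescribed so that the two injections of a double star can be rooted at
-- the endpoints of one given edge. Deleting `i` leaves at least `k` elements for the leaves.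
≤count⇒rooted-injection : {P : Pred (Fin n) 0ℓ} (P? : Decidable P) {i : Fin n} → P i → k < count P? →
  Σ[ (e , _) ∈ InjectionInto (suc k) P ] e zero ≡ i
≤count⇒rooted-injection {suc n} {k} {P} P? {i} Pi k<count =
  extend {P = P} Pi (e ∘ inj , (λ eq → Finₚ.inject≤-injective k≤ k≤ _ _ (e-inj eq)) , Pe ∘ inj) , refl
  where
  k≤ : k ≤ count (P? ∘ punchIn i)
  k≤ = ≤-pred (subst (k <_) (count-remove P? Pi) k<count)
  inj : Fin k → Fin (count (P? ∘ punchIn i))
  inj t = inject≤ t k≤
  into = enumerate (P? ∘ punchIn i)
  e = proj₁ into
  e-inj = proj₁ (proj₂ into)
  Pe = proj₂ (proj₂ into)

count-< : x ≤ n → count {n} (λ i → toℕ i <? x) ≡ x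
count-< {x} {n} x≤n = ≤-antisym
  (count≤ <x? (λ i i<x → fromℕ< i<x) λ p q eq → Finₚ.toℕ-injective
    (trans (sym (Finₚ.toℕ-fromℕ< p)) (trans (cong toℕ eq) (Finₚ.toℕ-fromℕ< q))))
  (injection⇒≤count <x?
    ( (λ t → inject≤ t x≤n)
    , Finₚ.inject≤-injective x≤n x≤n _ _
    , λ t → subst (_< _) (sym (Finₚ.toℕ-inject≤ t x≤n)) (Finₚ.toℕ<n t)))
  where
  <x? : Decidable λ (i : Fin n) → toℕ i < x
  <x? i = toℕ i <? x

-- Dominating sets as decidable relations.

Cells : ℕ → ℕ → Set₁
Cells n m = REL (Fin n) (Fin m) 0ℓ

size : {P : Cells n m} → Bin.Decidable P → ℕ
size {n} {m} P? = ∑[ j < n ] ∑[ i < m ] 𝟙 (P? j i)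

-- Both counts run over a whole line, including the cell itself. A cell outside `P` adds nothing to
-- them, so there they agree with the neighbour counts used by `𝒯`.
Dominates : ℕ → ℕ → {P : Cells n m} → Bin.Decidable P → Set
Dominates c d {P} P? = ∀ j i → P j i ⊎ c ≤ count (λ j′ → P? j′ i) ⊎ d ≤ count (P? j)

size-flip : {P : Cells n m} (P? : Bin.Decidable P) → size (flip P?) ≡ size P?
size-flip P? = ∑-comm λ i j → 𝟙 (P? j i)

dominates-flip : {P : Cells n m} {P? : Bin.Decidable P} →
                 Dominates c d P? → Dominates d c (flip P?)
dominates-flip dom i j = Sum.map₂ Sum.swap (dom j i)

dominates-cong : {P Q : Cells n m} {P? : Bin.Decidable P} {Q? : Bin.Decidable Q} →
                 (∀ j i → P j i ⇔ Q j i) → Dominates c d P? → Dominates c d Q?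
dominates-cong {c = c} {d} {P? = P?} {Q?} P⇔Q dom j i = Sum.map
  (Equivalence.to (P⇔Q j i))
  (Sum.map (subst (c ≤_) (count-cong (λ j′ → P? j′ i) (λ j′ → Q? j′ i) λ j′ → P⇔Q j′ i))
           (subst (d ≤_) (count-cong (P? j) (Q? j) (P⇔Q j))))
  (dom j i)

-- Lower bound by double counting.

module LowerBound {n m c d} {P : Cells n m} (P? : Bin.Decidable P) (dom : Dominates c d P?) where

  row : Fin m → ℕ
  row i = count λ j → P? j i

  col : Fin n → ℕ
  col j = count (P? j)

  X? : Decidable λ i → c ≤ row i
  X? i = c ≤? row i

  Y? : Decidable λ j → d ≤ col j
  Y? j = d ≤? col j

  X Y : ℕ
  X = count X?
  Y = count Y?

  corner : ℕ
  corner = (m ∸ X) * (n ∸ Y)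

  sum-corner : ∑[ j < n ] ∑[ i < m ] (𝟙 (¬? (Y? j)) * 𝟙 (¬? (X? i))) ≡ corner
  sum-corner = begin
    sum (λ j → sum λ i → 𝟙 (¬? (Y? j)) * 𝟙 (¬? (X? i)))
      ≡⟨ sum-product (λ j → 𝟙 (¬? (Y? j))) (λ i → 𝟙 (¬? (X? i))) ⟩
    count (¬? ∘ Y?) * count (¬? ∘ X?)  ≡⟨ cong₂ _*_ (count-¬-∸ Y?) (count-¬-∸ X?) ⟩
    (n ∸ Y) * (m ∸ X)                  ≡⟨ *-comm (n ∸ Y) (m ∸ X) ⟩
    corner                             ∎
    where open ≡-Reasoning

  -- Markov's inequality, keeping only the indices whose weight reaches `t`.
  threshold : (t : ℕ) (w : Fin k → ℕ) → count (λ i → t ≤? w i) * t ≤ ∑[ i < k ] (𝟙 (t ≤? w i) * w i)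
  threshold t w = ≤-trans (≤-reflexive (*-distribʳ-sum t (λ i → 𝟙 (t ≤? w i))))
    (sum-mono-≤ λ i → go (t ≤? w i))
    where
    go : ∀ {v} (t≤v? : Dec (t ≤ v)) → 𝟙 t≤v? * t ≤ 𝟙 t≤v? * v
    go (yes t≤v) = *-monoʳ-≤ 1 t≤v
    go (no _)    = z≤n

  X-rows : X * c ≤ ∑[ j < n ] ∑[ i < m ] (𝟙 (X? i) * 𝟙 (P? j i))
  X-rows = begin
    X * c                                       ≤⟨ threshold c row ⟩
    sum (λ i → 𝟙 (X? i) * row i)
      ≡⟨ sum-cong-≗ (λ i → *-distribˡ-sum (𝟙 (X? i)) (λ j → 𝟙 (P? j i))) ⟩
    sum (λ i → sum λ j → 𝟙 (X? i) * 𝟙 (P? j i))  ≡⟨ ∑-comm (λ i j → 𝟙 (X? i) * 𝟙 (P? j i)) ⟩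
    sum (λ j → sum λ i → 𝟙 (X? i) * 𝟙 (P? j i))  ∎
    where open ≤-Reasoning

  Y-cols : Y * d ≤ ∑[ j < n ] ∑[ i < m ] (𝟙 (Y? j) * 𝟙 (P? j i))
  Y-cols = ≤-trans (threshold d col)
    (≤-reflexive (sum-cong-≗ λ j → *-distribˡ-sum (𝟙 (Y? j)) (λ i → 𝟙 (P? j i))))

  ∑∑-distrib-+ : (f g : Fin n → Fin m → ℕ) →
    ∑[ j < n ] ∑[ i < m ] (f j i + g j i) ≡ ∑[ j < n ] ∑[ i < m ] f j i + ∑[ j < n ] ∑[ i < m ] g j i
  ∑∑-distrib-+ f g = trans (sum-cong-≗ λ j → ∑-distrib-+ (f j) (g j)) (∑-distrib-+ (sum ∘ f) (sum ∘ g))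

  -- The rows of `X?` are disjoint from the corner, so no cell is counted twice. Domination rules
  -- out a corner cell outside `P`, the last case of `cell`.
  rows+corner≤size : X * c + corner ≤ size P?
  rows+corner≤size = begin
    X * c + corner
      ≤⟨ +-mono-≤ X-rows (≤-reflexive (sym sum-corner)) ⟩
    _ ≡⟨ ∑∑-distrib-+ (λ j i → 𝟙 (X? i) * 𝟙 (P? j i)) (λ j i → 𝟙 (¬? (Y? j)) * 𝟙 (¬? (X? i))) ⟨
    sum (λ j → sum λ i → 𝟙 (X? i) * 𝟙 (P? j i) + 𝟙 (¬? (Y? j)) * 𝟙 (¬? (X? i)))
      ≤⟨ sum-mono-≤ (λ j → sum-mono-≤ λ i → cell (P? j i) (X? i) (Y? j) (dom j i)) ⟩
    size P? ∎
    where
    open ≤-Reasoning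
    cell : ∀ {A B C : Set} (p? : Dec A) (x? : Dec B) (y? : Dec C) → A ⊎ B ⊎ C →
           𝟙 x? * 𝟙 p? + 𝟙 (¬? y?) * 𝟙 (¬? x?) ≤ 𝟙 p?
    cell (yes _) (yes _) (yes _) _ = s≤s z≤n
    cell (yes _) (yes _) (no _)  _ = s≤s z≤n
    cell (yes _) (no _)  (yes _) _ = z≤n
    cell (yes _) (no _)  (no _)  _ = s≤s z≤n
    cell (no _)  (yes _) (yes _) _ = z≤n
    cell (no _)  (yes _) (no _)  _ = z≤n
    cell (no _)  (no _)  (yes _) _ = z≤n
    cell (no ¬a) (no ¬b) (no ¬c) h = contradiction h Sum.[ ¬a , Sum.[ ¬b , ¬c ] ]

  -- A cell of `P` lying both in a row of `X?` and in a column of `Y?` is counted twice; `Y * X`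
  -- pays for the second time.
  rows+cols+corner≤size : X * c + Y * d + corner ≤ size P? + Y * X
  rows+cols+corner≤size = begin
    X * c + Y * d + corner
      ≤⟨ +-mono-≤ (+-mono-≤ X-rows Y-cols) (≤-reflexive (sym sum-corner)) ⟩
    sum (λ j → sum (xp j)) + sum (λ j → sum (yp j)) + sum (λ j → sum (x̄ȳ j))
      ≡⟨ cong (_+ sum (λ j → sum (x̄ȳ j))) (∑∑-distrib-+ xp yp) ⟨
    sum (λ j → sum λ i → xp j i + yp j i) + sum (λ j → sum (x̄ȳ j))
      ≡⟨ ∑∑-distrib-+ (λ j i → xp j i + yp j i) x̄ȳ ⟨
    sum (λ j → sum λ i → xp j i + yp j i + x̄ȳ j i)
      ≤⟨ sum-mono-≤ (λ j → sum-mono-≤ λ i → cell (P? j i) (X? i) (Y? j) (dom j i)) ⟩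
    sum (λ j → sum λ i → 𝟙 (P? j i) + 𝟙 (Y? j) * 𝟙 (X? i))
      ≡⟨ ∑∑-distrib-+ (λ j i → 𝟙 (P? j i)) (λ j i → 𝟙 (Y? j) * 𝟙 (X? i)) ⟩
    size P? + sum (λ j → sum λ i → 𝟙 (Y? j) * 𝟙 (X? i))
      ≡⟨ cong (size P? +_) (sum-product (λ j → 𝟙 (Y? j)) (λ i → 𝟙 (X? i))) ⟩
    size P? + Y * X ∎
    where
    open ≤-Reasoning
    xp yp x̄ȳ : Fin n → Fin m → ℕ
    xp j i = 𝟙 (X? i) * 𝟙 (P? j i)
    yp j i = 𝟙 (Y? j) * 𝟙 (P? j i)
    x̄ȳ j i = 𝟙 (¬? (Y? j)) * 𝟙 (¬? (X? i))
    cell : ∀ {A B C : Set} (p? : Dec A) (x? : Dec B) (y? : Dec C) → A ⊎ B ⊎ C →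
           𝟙 x? * 𝟙 p? + 𝟙 y? * 𝟙 p? + 𝟙 (¬? y?) * 𝟙 (¬? x?) ≤ 𝟙 p? + 𝟙 y? * 𝟙 x?
    cell (yes _) (yes _) (yes _) _ = ≤-refl
    cell (yes _) (yes _) (no _)  _ = ≤-refl
    cell (yes _) (no _)  (yes _) _ = ≤-refl
    cell (yes _) (no _)  (no _)  _ = ≤-refl
    cell (no _)  (yes _) (yes _) _ = z≤n
    cell (no _)  (yes _) (no _)  _ = z≤n
    cell (no _)  (no _)  (yes _) _ = z≤n
    cell (no ¬a) (no ¬b) (no ¬c) h = contradiction h Sum.[ ¬a , Sum.[ ¬b , ¬c ] ]

cost : (m n c d x y : ℕ) → ℕ
cost m n c d x y = (m ∸ x) * (n ∸ y) + (c * x ⊔ d * y)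

-- Both counts of the block X × Y together give the bound
-- c x + d y + (m - x)(n - y) ≤ |A| + x y, whose solution for |A| decreases in
-- x ≤ d and y ≤ c, so that x and y may be rounded up to d and c.
round-up : ∀ {m n c d x y s} → c ≤ n → d ≤ m → x ≤ d → y ≤ c →
           x * c + y * d + (m ∸ x) * (n ∸ y) ≤ s + y * x → (m ∸ d) * (n ∸ c) + c * d ≤ s
round-up {x = x} {y} {s} c≤n d≤m x≤d y≤c h
  -- The slacks `d = x + u`, `c = y + v`, `m = d + a`, `n = c + b` eliminate truncated subtraction.
  -- The two sides then differ by exactly `u * b + a * v`.
  with m≤n⇒∃[o]m+o≡n x≤d | m≤n⇒∃[o]m+o≡n y≤c
... | u , refl | v , refl
  with m≤n⇒∃[o]m+o≡n d≤m | m≤n⇒∃[o]m+o≡n c≤n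
... | a , refl | b , refl
  rewrite m+n∸m≡n (x + u) a | m+n∸m≡n (y + v) b
        | +-assoc x u a | m+n∸m≡n x (u + a) | +-assoc y v b | m+n∸m≡n y (v + b) =
  +-cancelʳ-≤ (y * x) _ _ (≤-trans
    (subst (a * b + (y + v) * (x + u) + y * x ≤_) (identity x y u v a b) (m≤m+n _ (u * b + a * v))) h)
  where
  identity : ∀ x y u v a b → a * b + (y + v) * (x + u) + y * x + (u * b + a * v) ≡
             x * (y + v) + y * (x + u) + (u + a) * (v + b)
  identity = solve-∀

-- The pair `X`, `Y` is used where it is in range. If only `X` is too small, raising it to `d`
-- shrinks the corner and makes `d * Y` the maximum, so `cols` suffices; symmetrically for `Y` and
-- `rows`. If both are too small, neither bound alone is enough and the combined count is rounded
-- up.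
lower-bound : {P : Cells n m} (P? : Bin.Decidable P) → c ≤ n → d ≤ m → Dominates c d P? →
  ∃₂ λ x y → (d ≤ x × x ≤ m) × (c ≤ y × y ≤ n) × cost m n c d x y ≤ size P?
lower-bound {n} {m} {c} {d} P? c≤n d≤m dom = go (d ≤? X) (c ≤? Y)
  where
  open LowerBound P? dom using (X; Y; X?; Y?; rows+corner≤size; rows+cols+corner≤size)
  module Flipped = LowerBound (flip P?) (dominates-flip {P? = P?} dom)
  open ≤-Reasoning

  rows : (m ∸ X) * (n ∸ Y) + c * X ≤ size P?
  rows = begin
    (m ∸ X) * (n ∸ Y) + c * X  ≡⟨ +-comm ((m ∸ X) * (n ∸ Y)) (c * X) ⟩
    c * X + (m ∸ X) * (n ∸ Y)  ≡⟨ cong (_+ (m ∸ X) * (n ∸ Y)) (*-comm c X) ⟩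
    X * c + (m ∸ X) * (n ∸ Y)  ≤⟨ rows+corner≤size ⟩
    size P?                    ∎

  cols : (m ∸ X) * (n ∸ Y) + d * Y ≤ size P?
  cols = begin
    (m ∸ X) * (n ∸ Y) + d * Y  ≡⟨ cong₂ _+_ (*-comm (m ∸ X) (n ∸ Y)) (*-comm d Y) ⟩
    (n ∸ Y) * (m ∸ X) + Y * d  ≡⟨ +-comm ((n ∸ Y) * (m ∸ X)) (Y * d) ⟩
    Y * d + (n ∸ Y) * (m ∸ X)  ≤⟨ Flipped.rows+corner≤size ⟩
    size (flip P?)             ≡⟨ size-flip P? ⟩
    size P?                    ∎

  go : Dec (d ≤ X) → Dec (c ≤ Y) →
       ∃₂ λ x y → (d ≤ x × x ≤ m) × (c ≤ y × y ≤ n) × cost m n c d x y ≤ size P?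
  go (yes d≤X) (yes c≤Y) =
    X , Y , (d≤X , count≤n X?) , (c≤Y , count≤n Y?) ,
    ≤-trans (≤-reflexive (+-distribˡ-⊔ ((m ∸ X) * (n ∸ Y)) (c * X) (d * Y))) (⊔-lub rows cols)
  go (no d≰X) (yes c≤Y) = d , Y , (≤-refl , d≤m) , (c≤Y , count≤n Y?) , (begin
    (m ∸ d) * (n ∸ Y) + (c * d ⊔ d * Y)
      ≡⟨ cong ((m ∸ d) * (n ∸ Y) +_) (m≤n⇒m⊔n≡n (≤-trans (*-monoˡ-≤ d c≤Y) (≤-reflexive (*-comm Y d)))) ⟩
    (m ∸ d) * (n ∸ Y) + d * Y
      ≤⟨ +-monoˡ-≤ (d * Y) (*-monoˡ-≤ (n ∸ Y) (∸-monoʳ-≤ m (≰⇒≥ d≰X))) ⟩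
    (m ∸ X) * (n ∸ Y) + d * Y
      ≤⟨ cols ⟩
    size P? ∎)
  go (yes d≤X) (no c≰Y) = X , c , (d≤X , count≤n X?) , (≤-refl , c≤n) , (begin
    (m ∸ X) * (n ∸ c) + (c * X ⊔ d * c)
      ≡⟨ cong ((m ∸ X) * (n ∸ c) +_) (m≥n⇒m⊔n≡m (≤-trans (*-monoˡ-≤ c d≤X) (≤-reflexive (*-comm X c)))) ⟩
    (m ∸ X) * (n ∸ c) + c * X
      ≤⟨ +-monoˡ-≤ (c * X) (*-monoʳ-≤ (m ∸ X) (∸-monoʳ-≤ n (≰⇒≥ c≰Y))) ⟩
    (m ∸ X) * (n ∸ Y) + c * X
      ≤⟨ rows ⟩
    size P? ∎)
  go (no d≰X) (no c≰Y) = d , c , (≤-refl , d≤m) , (≤-refl , c≤n) , (begin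
    (m ∸ d) * (n ∸ c) + (c * d ⊔ d * c)
      ≡⟨ cong ((m ∸ d) * (n ∸ c) +_) (trans (cong (c * d ⊔_) (*-comm d c)) (⊔-idem (c * d))) ⟩
    (m ∸ d) * (n ∸ c) + c * d
      ≤⟨ round-up c≤n d≤m (≰⇒≥ d≰X) (≰⇒≥ c≰Y) rows+cols+corner≤size ⟩
    size P? ∎)

-- Upper bound by cyclic filling.

+-cancelˡ-% : ∀ s {t u} y .{{_ : NonZero y}} → t < y → u < y → (s + t) % y ≡ (s + u) % y → t ≡ u
+-cancelˡ-% s {t} {u} y@(suc y-1) t<y u<y eq =
  trans (sym (recover t<y)) (trans (cong (λ r → (r + (s * y-1) % y) % y) eq) (recover u<y))
  where
  open ≡-Reasoning
  -- `s * y-1` is an additive inverse of `s` modulo `y`: adding it leaves `t` plus a multiple of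
  -- `y`.
  recover : ∀ {t} → t < y → ((s + t) % y + (s * y-1) % y) % y ≡ t
  recover {t} t<y = begin
    ((s + t) % y + (s * y-1) % y) % y  ≡⟨ %-distribˡ-+ (s + t) (s * y-1) y ⟨
    (s + t + s * y-1) % y              ≡⟨ cong (_% y) (rearrange s t y-1) ⟩
    (t + s * y) % y                    ≡⟨ [m+kn]%n≡m%n t s y ⟩
    t % y                              ≡⟨ m<n⇒m%n≡m t<y ⟩
    t                                  ∎
    where
    rearrange : ∀ s t z → s + t + s * z ≡ t + s * suc z
    rearrange = solve-∀

-- Row i < x receives the c cyclically consecutive columns i c , … , i c + c - 1
-- modulo y.  Over all x rows the c x positions run through the y columns evenly,
-- so each column is hit at least d times as soon as d y ≤ c x.
module Cyclic (n m c d x y : ℕ) .{{_ : NonZero c}} .{{_ : NonZero y}}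
              (x≤m : x ≤ m) (c≤y : c ≤ y) (y≤n : y ≤ n) (dy≤cx : d * y ≤ c * x) where

  column : Fin m → Fin c → ℕ
  column i t = (toℕ i * c + toℕ t) % y

  Outer Inner : Cells n m
  Outer j i = ¬ toℕ i < x × ¬ toℕ j < y
  Inner j i = toℕ i < x × ∃ λ t → toℕ j ≡ column i t

  P? : Bin.Decidable (λ j i → Outer j i ⊎ Inner j i)
  P? j i = (¬? (toℕ i <? x) ×-dec ¬? (toℕ j <? y)) ⊎-dec
           (toℕ i <? x ×-dec any? λ t → toℕ j ≟ℕ column i t)

  row : Fin m → ℕ
  row i = count λ j → P? j i

  -- A row takes `c` consecutive residues, and `c ≤ y` keeps them from wrapping around onto each
  -- other.
  column-injective : ∀ i {t u} → column i t ≡ column i u → t ≡ u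
  column-injective i eq = Finₚ.toℕ-injective (+-cancelˡ-% (toℕ i * c) y (t<y _) (t<y _) eq)
    where
    t<y : ∀ t → toℕ t < y
    t<y t = <-≤-trans (Finₚ.toℕ<n t) c≤y

  c≤row : ∀ i → toℕ i < x → c ≤ row i
  c≤row i i<x = injection⇒≤count (λ j → P? j i)
    ( (λ t → fromℕ< (column<n t))
    , (λ {t} {u} eq → column-injective i (trans (sym (Finₚ.toℕ-fromℕ< (column<n t)))
        (trans (cong toℕ eq) (Finₚ.toℕ-fromℕ< (column<n u)))))
    , λ t → inj₂ (i<x , t , Finₚ.toℕ-fromℕ< (column<n t)))
    where
    column<n : ∀ t → column i t < n
    column<n t = <-≤-trans (m%n<n _ y) y≤n

  row≤c : ∀ i → toℕ i < x → row i ≤ c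
  row≤c i i<x = count≤ (λ j → P? j i) (λ j → index) λ {j} {k} p q eq →
    Finₚ.toℕ-injective (trans (index-column p) (trans (cong (column i) eq) (sym (index-column q))))
    where
    index : ∀ {j} → Outer j i ⊎ Inner j i → Fin c
    index (inj₁ (i≮x , _))   = contradiction i<x i≮x
    index (inj₂ (_ , t , _)) = t
    index-column : ∀ {j} (p : Outer j i ⊎ Inner j i) → toℕ j ≡ column i (index p)
    index-column (inj₁ (i≮x , _))    = contradiction i<x i≮x
    index-column (inj₂ (_ , _ , eq)) = eq

  row≡n∸y : ∀ i → ¬ toℕ i < x → row i ≡ n ∸ y
  row≡n∸y i i≮x = begin
    row i                                      ≡⟨ count-cong (λ j → P? j i) (λ j → ¬? (toℕ j <? y)) (λ j → mk⇔
      Sum.[ proj₂ , (λ (i<x , _) → contradiction i<x i≮x) ] λ j≮y → inj₁ (i≮x , j≮y)) ⟩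
    count {n} (λ j → ¬? (toℕ j <? y))          ≡⟨ count-¬-∸ (λ (j : Fin n) → toℕ j <? y) ⟩
    n ∸ count {n} (λ j → toℕ j <? y)           ≡⟨ cong (n ∸_) (count-< y≤n) ⟩
    n ∸ y                                      ∎
    where open ≡-Reasoning

  -- Concatenating the rows gives a list of `x * c` positions, where position `s` belongs to row
  -- `s / c` and column `s % y`. The positions `j + k * y` with `k < d` all fall in column `j`, and
  -- `d * y ≤ c * x` keeps them within the list.
  d≤col : ∀ j → toℕ j < y → d ≤ count (P? j)
  d≤col j j<y = injection⇒≤count (P? j) (row-of , row-of-injective _ _ , λ k → inj₂ (row-of<x k , hit k))
    where
    s : Fin d → ℕ
    s k = toℕ j + toℕ k * y

    s<cx : ∀ k → s k < x * c
    s<cx k = begin-strict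
      toℕ j + toℕ k * y  <⟨ +-monoˡ-< (toℕ k * y) j<y ⟩
      suc (toℕ k) * y    ≤⟨ *-monoˡ-≤ y (Finₚ.toℕ<n k) ⟩
      d * y              ≤⟨ dy≤cx ⟩
      c * x              ≡⟨ *-comm c x ⟩
      x * c              ∎
      where open ≤-Reasoning

    quotient<m : ∀ k → s k / c < m
    quotient<m k = <-≤-trans (m<n*o⇒m/o<n (s<cx k)) x≤m

    row-of : Fin d → Fin m
    row-of k = fromℕ< (quotient<m k)

    toℕ-row-of : ∀ k → toℕ (row-of k) ≡ s k / c
    toℕ-row-of k = Finₚ.toℕ-fromℕ< (quotient<m k)

    row-of<x : ∀ k → toℕ (row-of k) < x
    row-of<x k = subst (_< x) (sym (toℕ-row-of k)) (m<n*o⇒m/o<n (s<cx k))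

    -- Successive positions are `y` apart, at least a full row length `c`, so they lie in different
    -- rows.
    quotient-mono-< : ∀ {k l} → k Fin.< l → s k / c < s l / c
    quotient-mono-< {k} {l} k<l = begin-strict
      s k / c          <⟨ n<1+n _ ⟩
      1 + s k / c      ≡⟨ +-comm 1 _ ⟩
      s k / c + 1      ≡⟨ cong (s k / c +_) (n/n≡1 c) ⟨
      s k / c + c / c  ≡⟨ +-distrib-/-∣ʳ (s k) ∣-refl ⟨
      (s k + c) / c    ≤⟨ /-monoˡ-≤ c step ⟩
      s l / c          ∎
      where
      open ≤-Reasoning
      step : s k + c ≤ s l
      step = begin
        toℕ j + toℕ k * y + c    ≤⟨ +-monoʳ-≤ (s k) c≤y ⟩
        toℕ j + toℕ k * y + y    ≡⟨ +-assoc (toℕ j) (toℕ k * y) y ⟩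
        toℕ j + (toℕ k * y + y)  ≡⟨ cong (toℕ j +_) (+-comm (toℕ k * y) y) ⟩
        toℕ j + suc (toℕ k) * y  ≤⟨ +-monoʳ-≤ (toℕ j) (*-monoˡ-≤ y k<l) ⟩
        toℕ j + toℕ l * y        ∎

    row-of-injective : ∀ k l → row-of k ≡ row-of l → k ≡ l
    row-of-injective k l eq with Finₚ.<-cmp k l
    ... | Bin.tri< k<l _ _ =
      contradiction (trans (sym (toℕ-row-of k)) (trans (cong toℕ eq) (toℕ-row-of l)))
                    (<⇒≢ (quotient-mono-< k<l))
    ... | Bin.tri≈ _ k≡l _ = k≡l
    ... | Bin.tri> _ _ l<k =
      contradiction (trans (sym (toℕ-row-of l)) (trans (cong toℕ (sym eq)) (toℕ-row-of k)))
                    (<⇒≢ (quotient-mono-< l<k))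

    hit : ∀ k → ∃ λ t → toℕ j ≡ column (row-of k) t
    -- The offset inside the row is the remainder of the position modulo `c`.
    hit k = fromℕ< (m%n<n (s k) c) , (begin
      toℕ j                             ≡⟨ m<n⇒m%n≡m j<y ⟨
      toℕ j % y                         ≡⟨ [m+kn]%n≡m%n (toℕ j) (toℕ k) y ⟨
      s k % y                           ≡⟨ cong (_% y) (m≡m%n+[m/n]*n (s k) c) ⟩
      (s k % c + s k / c * c) % y       ≡⟨ cong (_% y) (+-comm (s k % c) _) ⟩
      (s k / c * c + s k % c) % y       ≡⟨ cong (_% y) (cong₂ (λ q r → q * c + r)
                                             (toℕ-row-of k) (Finₚ.toℕ-fromℕ< (m%n<n (s k) c))) ⟨
      column (row-of k) _               ∎)
      where open ≡-Reasoning

  dominates : Dominates c d P?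
  dominates j i with toℕ i <? x | toℕ j <? y
  ... | yes i<x | _       = inj₂ (inj₁ (c≤row i i<x))
  ... | no _    | yes j<y = inj₂ (inj₂ (d≤col j j<y))
  ... | no i≮x  | no j≮y  = inj₁ (inj₁ (i≮x , j≮y))

  -- Summation row by row: at most `c` for each row below `x`, and `n ∸ y` for each of the others.
  size≤ : size P? ≤ (m ∸ x) * (n ∸ y) + c * x
  size≤ = begin
    size P?
      ≡⟨ size-flip P? ⟨
    sum row
      ≤⟨ sum-mono-≤ row≤ ⟩
    sum (λ i → 𝟙 (¬? (X? i)) * (n ∸ y) + 𝟙 (X? i) * c)
      ≡⟨ ∑-distrib-+ (λ i → 𝟙 (¬? (X? i)) * (n ∸ y)) (λ i → 𝟙 (X? i) * c) ⟩
    sum (λ i → 𝟙 (¬? (X? i)) * (n ∸ y)) + sum (λ i → 𝟙 (X? i) * c)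
      ≡⟨ cong₂ _+_ (*-distribʳ-sum (n ∸ y) (λ i → 𝟙 (¬? (X? i)))) (*-distribʳ-sum c (λ i → 𝟙 (X? i))) ⟨
    count (λ i → ¬? (X? i)) * (n ∸ y) + count X? * c
      ≡⟨ cong (λ u → u * (n ∸ y) + count X? * c) (count-¬-∸ X?) ⟩
    (m ∸ count X?) * (n ∸ y) + count X? * c
      ≡⟨ cong (λ u → (m ∸ u) * (n ∸ y) + u * c) (count-< x≤m) ⟩
    (m ∸ x) * (n ∸ y) + x * c
      ≡⟨ cong ((m ∸ x) * (n ∸ y) +_) (*-comm x c) ⟩
    (m ∸ x) * (n ∸ y) + c * x ∎
    where
    open ≤-Reasoning
    X? : Decidable λ (i : Fin m) → toℕ i < x
    X? i = toℕ i <? x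
    row≤ : ∀ i → row i ≤ 𝟙 (¬? (X? i)) * (n ∸ y) + 𝟙 (X? i) * c
    row≤ i = by-cases (X? i) (row≤c i) (≤-reflexive ∘ row≡n∸y i)
      where
      by-cases : ∀ {B : Set} {r u v} (b? : Dec B) → (B → r ≤ v) → (¬ B → r ≤ u) →
                 r ≤ 𝟙 (¬? b?) * u + 𝟙 b? * v
      by-cases {v = v} (yes b) h _ = ≤-trans (h b) (≤-reflexive (sym (*-identityˡ v)))
      by-cases {u = u} (no ¬b) _ h =
        ≤-trans (h ¬b) (≤-reflexive (sym (trans (+-identityʳ _) (*-identityˡ u))))

-- The filling must have the larger of `c * x` and `d * y` as its inner size. When that is `d * y`,
-- it is built with rows and columns exchanged and then flipped.
upper-bound : .{{_ : NonZero c}} .{{_ : NonZero d}} → d ≤ x → x ≤ m → c ≤ y → y ≤ n →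
  Σ[ P ∈ Cells n m ] Σ[ P? ∈ Bin.Decidable P ] Dominates c d P? × size P? ≤ cost m n c d x y
upper-bound {c} {d} {x} {m} {y} {n} d≤x x≤m c≤y y≤n with ≤-total (d * y) (c * x)
... | inj₁ dy≤cx = _ , P? , dominates ,
      ≤-trans size≤ (+-monoʳ-≤ ((m ∸ x) * (n ∸ y)) (m≤m⊔n (c * x) (d * y)))
  where
  instance _ = ≢-nonZero (m<n⇒n≢0 (<-≤-trans (>-nonZero⁻¹ c) c≤y))
  open Cyclic n m c d x y x≤m c≤y y≤n dy≤cx
... | inj₂ cx≤dy = _ , flip P? , dominates-flip {P? = P?} dominates , (begin
    size (flip P?)                       ≡⟨ size-flip P? ⟩
    size P?                              ≤⟨ size≤ ⟩
    (n ∸ y) * (m ∸ x) + d * y            ≡⟨ cong (_+ d * y) (*-comm (n ∸ y) (m ∸ x)) ⟩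
    (m ∸ x) * (n ∸ y) + d * y            ≤⟨ +-monoʳ-≤ ((m ∸ x) * (n ∸ y)) (m≤n⊔m (c * x) (d * y)) ⟩
    cost m n c d x y                     ∎)
  where
  instance _ = ≢-nonZero (m<n⇒n≢0 (<-≤-trans (>-nonZero⁻¹ d) d≤x))
  open Cyclic m n d c y x y≤n d≤x x≤m cx≤dy
  open ≤-Reasoning

-- From subsets and `𝒯` to counts.

∣∣-count : (A : Subset n) → ∣ A ∣ ≡ count (_∈ˢ? A)
∣∣-count []          = refl
∣∣-count (true ∷ A)  = cong suc (∣∣-count A)
∣∣-count (false ∷ A) = ∣∣-count A

∣∣-size : (A : Subset (n * m)) → ∣ A ∣ ≡ size {n} {m} (λ j i → (j , i) ∈ᵖ? A)
∣∣-size {n} A = trans (∣∣-count A) (sum-combine n (λ v → 𝟙 (v ∈ˢ? A)))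

∈⟦⟧ : {P : Pred (Fin k × Fin l) 0ℓ} (P? : Decidable P) (j : Fin k) (i : Fin l) → (j , i) ∈ᵖ ⟦ P? ⟧ ⇔ P (j , i)
∈⟦⟧ {k} {l} {P} P? j i = mk⇔ to from
  where
  entry : ∀ v → lookup ⟦ P? ⟧ v ≡ does (P? (remQuot {k} l v))
  entry = lookup∘tabulate (λ v → does (P? (remQuot {k} l v)))

  to : (j , i) ∈ᵖ ⟦ P? ⟧ → P (j , i)
  to ∈P with P? (remQuot {k} l (combine j i)) | trans (sym (entry (combine j i))) ([]=⇒lookup ∈P)
  ... | yes p | _ = subst P (Finₚ.remQuot-combine j i) p

  from : P (j , i) → (j , i) ∈ᵖ ⟦ P? ⟧
  from p = lookup⇒[]= _ _ (trans (entry (combine j i))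
    (dec-true (P? _) (subst P (sym (Finₚ.remQuot-combine j i)) p)))

module Domination {n m} (A : Subset (n * m)) where

  A? : Bin.Decidable λ (j : Fin n) (i : Fin m) → (j , i) ∈ᵖ A
  A? j i = (j , i) ∈ᵖ? A

  -- The neighbourhoods omit the cell itself, but it is not in `A`, so restoring it changes neither
  -- count.
  counts-∉ : ∀ j i → ¬ (j , i) ∈ᵖ A → counts A (j , i) ≡ (count (λ j′ → A? j′ i) , count (A? j))
  counts-∉ j i v∉A = cong₂ _,_ row col
    where
    Row? : Decidable λ ((j′ , i′) : Fin n × Fin m) → j′ ≢ j × i′ ≡ i
    Row? (j′ , i′) = ¬? (j′ ≟ j) ×-dec i′ ≟ i

    Col? : Decidable λ ((j′ , i′) : Fin n × Fin m) → j′ ≡ j × i′ ≢ i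
    Col? (j′ , i′) = j′ ≟ j ×-dec ¬? (i′ ≟ i)

    Row∩A Col∩A : Subset (n * m)
    Row∩A = Nʳ {n} {m} (j , i) Sub.∩ A
    Col∩A = Nᶜ {n} {m} (j , i) Sub.∩ A

    r? : Bin.Decidable λ (j′ : Fin n) (i′ : Fin m) → (j′ , i′) ∈ᵖ Row∩A
    r? j′ i′ = (j′ , i′) ∈ᵖ? Row∩A

    c? : Bin.Decidable λ (j′ : Fin n) (i′ : Fin m) → (j′ , i′) ∈ᵖ Col∩A
    c? j′ i′ = (j′ , i′) ∈ᵖ? Col∩A

    ∈r : ∀ (j′ : Fin n) (i′ : Fin m) → (j′ , i′) ∈ᵖ Row∩A → i′ ≡ i × (j′ , i′) ∈ᵖ A
    ∈r j′ i′ ∈∩ = let ∈N , ∈A = x∈p∩q⁻ _ A ∈∩ in proj₂ (Equivalence.to (∈⟦⟧ Row? j′ i′) ∈N) , ∈A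

    ∈c : ∀ (j′ : Fin n) (i′ : Fin m) → (j′ , i′) ∈ᵖ Col∩A → j′ ≡ j × (j′ , i′) ∈ᵖ A
    ∈c j′ i′ ∈∩ = let ∈N , ∈A = x∈p∩q⁻ _ A ∈∩ in proj₁ (Equivalence.to (∈⟦⟧ Col? j′ i′) ∈N) , ∈A

    𝟙-no : (b? : Dec B) → ¬ B → 𝟙 b? ≡ 0
    𝟙-no (yes b) ¬b = contradiction b ¬b
    𝟙-no (no _)  _  = refl

    row : ∣ Row∩A ∣ ≡ count (λ j′ → A? j′ i)
    row = begin
      ∣ Row∩A ∣               ≡⟨ ∣∣-size {n} {m} Row∩A ⟩
      size r?                 ≡⟨ sum-cong-≗ (λ j′ → sum-single (λ i′ → 𝟙 (r? j′ i′)) i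
                                   λ i′ i′≢i → 𝟙-no (r? j′ i′) (i′≢i ∘ proj₁ ∘ ∈r j′ i′)) ⟩
      count (λ j′ → r? j′ i)  ≡⟨ count-cong (λ j′ → r? j′ i) (λ j′ → A? j′ i) (λ j′ →
                                   mk⇔ (proj₂ ∘ ∈r j′ i) λ ∈A →
                                     x∈p∩q⁺ (Equivalence.from (∈⟦⟧ Row? j′ i)
                                       ((λ { refl → v∉A ∈A }) , refl) , ∈A)) ⟩
      count (λ j′ → A? j′ i)  ∎
      where open ≡-Reasoning

    col : ∣ Col∩A ∣ ≡ count (A? j)
    col = begin
      ∣ Col∩A ∣               ≡⟨ ∣∣-size {n} {m} Col∩A ⟩
      size c?                 ≡⟨ sum-single (λ j′ → sum λ i′ → 𝟙 (c? j′ i′)) j (λ j′ j′≢j →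
                                   sum-zero λ i′ → 𝟙-no (c? j′ i′) (j′≢j ∘ proj₁ ∘ ∈c j′ i′)) ⟩
      count (c? j)            ≡⟨ count-cong (c? j) (A? j) (λ i′ →
                                   mk⇔ (proj₂ ∘ ∈c j i′) λ ∈A →
                                     x∈p∩q⁺ (Equivalence.from (∈⟦⟧ Col? j i′)
                                       (refl , (λ { refl → v∉A ∈A })) , ∈A)) ⟩
      count (A? j)            ∎
      where open ≡-Reasoning

  𝒯≡⊤⇔dominates : 𝒯 n m (R c d) A ≡ ⊤ ⇔ Dominates c d A?
  𝒯≡⊤⇔dominates {c} {d} = mk⇔ to from
    where
    New? : Decidable λ (v : Fin n × Fin m) → ¬ (v ∈ᵖ A) × ¬ points (R c d) (counts A v)
    New? v = ¬? (v ∈ᵖ? A) ×-dec ¬? (points? (R c d) (counts A v))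

    to : 𝒯 n m (R c d) A ≡ ⊤ → Dominates c d A?
    to 𝒯≡⊤ j i with x∈p∪q⁻ A ⟦ New? ⟧ (subst (combine j i Sub.∈_) (sym 𝒯≡⊤) ∈⊤)
    ... | inj₁ ∈A = inj₁ ∈A
    ... | inj₂ ∈New with Equivalence.to (∈⟦⟧ New? j i) ∈New
    ... | ∉A , ∉R with c ≤? count (λ j′ → A? j′ i) | d ≤? count (A? j)
    ... | yes c≤ | _      = inj₂ (inj₁ c≤)
    ... | no _   | yes d≤ = inj₂ (inj₂ d≤)
    ... | no c≰  | no d≰  = contradiction
      (subst (points (R c d)) (sym (counts-∉ j i ∉A)) (≰⇒> c≰ , ≰⇒> d≰)) ∉R

    everywhere : Dominates c d A? → ∀ j i → (j , i) ∈ᵖ 𝒯 n m (R c d) A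
    everywhere dom j i with A? j i
    ... | yes ∈A = x∈p∪q⁺ (inj₁ ∈A)
    ... | no ∉A  = x∈p∪q⁺ (inj₂ (Equivalence.from (∈⟦⟧ New? j i)
      (∉A , λ ∈R → outside (subst (points (R c d)) (counts-∉ j i ∉A) ∈R) (dom j i))))
      where
      outside : points (R c d) (count (λ j′ → A? j′ i) , count (A? j)) →
                ¬ ((j , i) ∈ᵖ A ⊎ c ≤ count (λ j′ → A? j′ i) ⊎ d ≤ count (A? j))
      outside _         (inj₁ ∈A)        = ∉A ∈A
      outside (r<c , _) (inj₂ (inj₁ c≤)) = <⇒≱ r<c c≤
      outside (_ , k<d) (inj₂ (inj₂ d≤)) = <⇒≱ k<d d≤

    from : Dominates c d A? → 𝒯 n m (R c d) A ≡ ⊤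
    from dom = ⊆-antisym ⊆⊤ λ {v} _ → let j , i , eq = Finₚ.combine-surjective {n} {m} v in
      subst (Sub._∈ 𝒯 n m (R c d) A) eq (everywhere dom j i)

-- Complements and double stars.

-- Transposed because γ indexes a cell as (j , i), a graph an edge as (i , j).
coTranspose : ∀ k l → Subset (k * l) → Subset (l * k)
coTranspose k l A = ⟦ (λ ((i , j) : Fin l × Fin k) → ¬? ((j , i) ∈ᵖ? A)) ⟧

∈coTranspose : ∀ k l (A : Subset (k * l)) (i : Fin l) (j : Fin k) →
               (i , j) ∈ᵖ coTranspose k l A ⇔ (¬ (j , i) ∈ᵖ A)
∈coTranspose k l A = ∈⟦⟧ λ ((i , j) : Fin l × Fin k) → ¬? ((j , i) ∈ᵖ? A)

∣coTranspose∣ : ∀ k l (A : Subset (k * l)) → ∣ A ∣ + ∣ coTranspose k l A ∣ ≡ k * l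
∣coTranspose∣ k l A = begin
  ∣ A ∣ + ∣ coTranspose k l A ∣
    ≡⟨ cong₂ _+_ (∣∣-size {k} {l} A) (∣∣-size {l} {k} (coTranspose k l A)) ⟩
  size A? + size Aᶜ?
    ≡⟨ cong (size A? +_) (size-flip Aᶜ?) ⟨
  size A? + size (flip Aᶜ?)
    ≡⟨ ∑-distrib-+ (λ j → count (A? j)) (λ j → count λ i → Aᶜ? i j) ⟨
  sum (λ j → count (A? j) + count (λ i → Aᶜ? i j))
    ≡⟨ sum-cong-≗ (λ j → cong (count (A? j) +_)
         (count-cong (λ i → Aᶜ? i j) (λ i → ¬? (A? j i)) λ i → ∈coTranspose k l A i j)) ⟩
  sum (λ j → count (A? j) + count (λ i → ¬? (A? j i)))
    ≡⟨ sum-cong-≗ (λ j → count-¬ (A? j)) ⟩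
  ∑[ j < k ] l                ≡⟨ sum-cong-≗ {k} (λ _ → *-identityˡ l) ⟨
  ∑[ j < k ] (1 * l)          ≡⟨ *-distribʳ-sum {k} l (λ _ → 1) ⟨
  (∑[ j < k ] 1) * l          ≡⟨ cong (_* l) (sum-one k) ⟩
  k * l                       ∎
  where
  open ≡-Reasoning
  A? : Bin.Decidable λ (j : Fin k) (i : Fin l) → (j , i) ∈ᵖ A
  A? j i = (j , i) ∈ᵖ? A
  Aᶜ? : Bin.Decidable λ (i : Fin l) (j : Fin k) → (i , j) ∈ᵖ coTranspose k l A
  Aᶜ? i j = (i , j) ∈ᵖ? coTranspose k l A

module DoubleStar {m n} (G : BipartiteGraph m n) (a b : ℕ) where

  G? : Bin.Decidable λ (i : Fin m) (j : Fin n) → (i , j) ∈ᵖ G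
  G? i j = (i , j) ∈ᵖ? G

  NonEdge? : Bin.Decidable λ (j : Fin n) (i : Fin m) → ¬ (i , j) ∈ᵖ G
  NonEdge? j i = ¬? (G? i j)

  -- An edge whose endpoints have degrees above `a` and `b` spans a double star: the two sets of
  -- leaves lie in opposite parts, so they can be chosen independently. Otherwise one endpoint has
  -- small degree, hence enough non-neighbours.
  free⇒dominates : Free m n (singleStar a b) G → Dominates (n ∸ a) (m ∸ b) NonEdge?
  free⇒dominates free j i with G? i j
  ... | no ∉G = inj₁ ∉G
  ... | yes ∈G with a <? count (G? i) | b <? count (λ i′ → G? i′ j)
  ... | no a≮ | _ = inj₂ (inj₁
    (≤-trans (∸-monoʳ-≤ n (≮⇒≥ a≮)) (≤-reflexive (sym (count-¬-∸ (G? i))))))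
  ... | yes _ | no b≮ = inj₂ (inj₂
    (≤-trans (∸-monoʳ-≤ m (≮⇒≥ b≮)) (≤-reflexive (sym (count-¬-∸ (λ i′ → G? i′ j))))))
  ... | yes a< | yes b<
    with ≤count⇒rooted-injection (G? i) ∈G a< | ≤count⇒rooted-injection (λ i′ → G? i′ j) ∈G b<
  ... | (g , g-inj , ∈Gᵢ) , refl | (f , f-inj , ∈Gⱼ) , refl = contradiction
    (record { f = f ; g = g ; f-injective = f-inj ; g-injective = g-inj ; edges = edges }) (free refl)
    where
    edges : ∀ {x y} → StarEdge x y → (f x , g y) ∈ᵖ G
    edges centres    = ∈G
    edges (u-leaf k) = ∈Gᵢ (suc k)
    edges (v-leaf k) = ∈Gⱼ (suc k)

  dominates⇒free : Dominates (n ∸ a) (m ∸ b) NonEdge? → Free m n (singleStar a b) G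
  dominates⇒free dom refl star = absurd (dom (g zero) (f zero))
    where
    open Contains star

    a< : a < count (G? (f zero))
    a< = injection⇒≤count (G? (f zero))
      (g , g-injective , λ { zero → edges centres ; (suc k) → edges (u-leaf k) })

    b< : b < count (λ i → G? i (g zero))
    b< = injection⇒≤count (λ i → G? i (g zero))
      (f , f-injective , λ { zero → edges centres ; (suc k) → edges (v-leaf k) })

    absurd : ¬ (¬ (f zero , g zero) ∈ᵖ G ⊎
                n ∸ a ≤ count (λ j → NonEdge? j (f zero)) ⊎
                m ∸ b ≤ count (NonEdge? (g zero)))
    absurd (inj₁ ∉G) = ∉G (edges centres)
    -- Since the degree is at most `n`, truncated subtraction remains strictly decreasing here.
    absurd (inj₂ (inj₁ h)) = <⇒≱ (∸-monoʳ-< a< (count≤n (G? (f zero))))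
      (≤-trans h (≤-reflexive (count-¬-∸ (G? (f zero)))))
    absurd (inj₂ (inj₂ h)) = <⇒≱ (∸-monoʳ-< b< (count≤n (λ i → G? i (g zero))))
      (≤-trans h (≤-reflexive (count-¬-∸ (λ i → G? i (g zero)))))

-- The extremal number and the formula for `γ`.

γ≤ : (A : Subset (n * m)) → Dominates {n} {m} c d (λ j i → (j , i) ∈ᵖ? A) → γ (R c d) m n ≤ ∣ A ∣
γ≤ {n} {m} {c} {d} A dom = proj₂ (proj₂ (γ-minimum (R c d) m n))
  (A , Equivalence.from (Domination.𝒯≡⊤⇔dominates {n} {m} A) dom , refl)

γ-attained : ∃ λ (A : Subset (n * m)) → Dominates {n} {m} c d (λ j i → (j , i) ∈ᵖ? A) × ∣ A ∣ ≡ γ (R c d) m n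
γ-attained {n} {m} {c} {d} = let A , 𝒯≡⊤ , ∣A∣≡γ = proj₁ (proj₂ (γ-minimum (R c d) m n)) in
  A , Equivalence.to (Domination.𝒯≡⊤⇔dominates {n} {m} A) 𝒯≡⊤ , ∣A∣≡γ

-- Complementation exchanges free graphs with dominating sets, and the two sizes add up to `m * n`.
-- An optimal object on either side therefore bounds the optimum on the other.
ex≡mn∸γ : ∀ m n a b → ex m n (singleStar a b) ≡ m * n ∸ γ (R (n ∸ a) (m ∸ b)) m n
ex≡mn∸γ m n a b = ≤-antisym ex≤ ex≥
  where
  open ≤-Reasoning

  ex≤ : ex m n (singleStar a b) ≤ m * n ∸ γ (R (n ∸ a) (m ∸ b)) m n
  ex≤ with proj₁ (proj₂ (ex-maximum m n (singleStar a b)))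
  ... | G , free , ∣G∣≡ex = begin
    ex m n (singleStar a b)                 ≡⟨ ∣G∣≡ex ⟨
    ∣ G ∣                                   ≡⟨ m+n∸n≡m ∣ G ∣ ∣ Gᶜ ∣ ⟨
    ∣ G ∣ + ∣ Gᶜ ∣ ∸ ∣ Gᶜ ∣                 ≡⟨ cong (_∸ ∣ Gᶜ ∣) (∣coTranspose∣ m n G) ⟩
    m * n ∸ ∣ Gᶜ ∣                          ≤⟨ ∸-monoʳ-≤ (m * n) (γ≤ {n} {m} Gᶜ dom) ⟩
    m * n ∸ γ (R (n ∸ a) (m ∸ b)) m n       ∎
    where
    Gᶜ = coTranspose m n G
    dom : Dominates {n} {m} (n ∸ a) (m ∸ b) (λ j i → (j , i) ∈ᵖ? Gᶜ)
    dom = dominates-cong {P? = DoubleStar.NonEdge? G a b} {Q? = λ j i → (j , i) ∈ᵖ? Gᶜ}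
      (λ j i → let open Equivalence (∈coTranspose m n G j i) in mk⇔ from to)
      (DoubleStar.free⇒dominates G a b free)

  ex≥ : m * n ∸ γ (R (n ∸ a) (m ∸ b)) m n ≤ ex m n (singleStar a b)
  ex≥ with γ-attained {n} {m} {n ∸ a} {m ∸ b}
  ... | A , dom , ∣A∣≡γ = begin
    m * n ∸ γ (R (n ∸ a) (m ∸ b)) m n       ≡⟨ cong₂ _∸_ (*-comm m n) (sym ∣A∣≡γ) ⟩
    n * m ∸ ∣ A ∣                           ≡⟨ cong (_∸ ∣ A ∣) (∣coTranspose∣ n m A) ⟨
    ∣ A ∣ + ∣ Aᶜ ∣ ∸ ∣ A ∣                  ≡⟨ m+n∸m≡n ∣ A ∣ ∣ Aᶜ ∣ ⟩
    ∣ Aᶜ ∣                                  ≤⟨ proj₂ (proj₂ (ex-maximum m n (singleStar a b)))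
                                                 (Aᶜ , DoubleStar.dominates⇒free Aᶜ a b dom′ , refl) ⟩
    ex m n (singleStar a b)                 ∎
    where
    Aᶜ = coTranspose n m A
    dom′ : Dominates (n ∸ a) (m ∸ b) (DoubleStar.NonEdge? Aᶜ a b)
    dom′ = dominates-cong {P? = λ j i → (j , i) ∈ᵖ? A} {Q? = DoubleStar.NonEdge? Aᶜ a b}
      -- The non-edges of the complement are the cells of `A`; decidable membership removes the
      -- double negation.
      (λ j i → let open Equivalence (∈coTranspose n m A i j) in
        mk⇔ (λ ∈A ∈Aᶜ → to ∈Aᶜ ∈A) λ ∉Aᶜ → decidable-stable ((j , i) ∈ᵖ? A) (∉Aᶜ ∘ from))
      dom

-- Cyclic fillings bound `γ` by every admissible cost, while a minimum dominating set yields an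
-- admissible pair of cost at most `γ`. At that pair equality holds.
γ-formula : .{{_ : NonZero c}} .{{_ : NonZero d}} → c ≤ n → d ≤ m →
  IsMinimum (λ k → ∃₂ λ x y → (d ≤ x × x ≤ m) × (c ≤ y × y ≤ n) × k ≡ cost m n c d x y) (γ (R c d) m n)
γ-formula {c} {d} {n} {m} c≤n d≤m = attained ,
  λ { (x , y , x-range , y-range , refl) → γ≤cost x-range y-range }
  where
  open ≤-Reasoning

  γ≤cost : ∀ {x y} → d ≤ x × x ≤ m → c ≤ y × y ≤ n → γ (R c d) m n ≤ cost m n c d x y
  γ≤cost {x} {y} (d≤x , x≤m) (c≤y , y≤n) with upper-bound {c} {d} d≤x x≤m c≤y y≤n
  ... | P , P? , dom , size≤ = begin
    γ (R c d) m n     ≤⟨ γ≤ {n} {m} S (dominates-cong {P? = P?} {Q? = S?}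
                           (λ j i → let open Equivalence (∈S j i) in mk⇔ from to) dom) ⟩
    ∣ S ∣             ≡⟨ ∣∣-size {n} {m} S ⟩
    size S?           ≡⟨ sum-cong-≗ (λ j → count-cong (S? j) (P? j) (∈S j)) ⟩
    size P?           ≤⟨ size≤ ⟩
    cost m n c d x y  ∎
    where
    S : Subset (n * m)
    S = ⟦ (λ (j , i) → P? j i) ⟧
    S? : Bin.Decidable λ (j : Fin n) (i : Fin m) → (j , i) ∈ᵖ S
    S? j i = (j , i) ∈ᵖ? S
    ∈S : ∀ j i → (j , i) ∈ᵖ S ⇔ P j i
    ∈S = ∈⟦⟧ λ (j , i) → P? j i

  attained : ∃₂ λ x y → (d ≤ x × x ≤ m) × (c ≤ y × y ≤ n) × γ (R c d) m n ≡ cost m n c d x y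
  attained with γ-attained {n} {m} {c} {d}
  ... | A , dom , ∣A∣≡γ with lower-bound (λ j i → (j , i) ∈ᵖ? A) c≤n d≤m dom
  ... | x , y , x-range , y-range , cost≤ = x , y , x-range , y-range , ≤-antisym (γ≤cost x-range y-range)
    (≤-trans cost≤ (≤-reflexive (trans (sym (∣∣-size {n} {m} A)) ∣A∣≡γ)))

-- Convex corners and duality.

below-convexCorner : ∀ E → points E ⊆ points (R n m) → ∀ {p} → points E p → ∃ λ q → ConvexCorner E q × p ≼ q
below-convexCorner {n} {m} E E⊆R {x , y} p∈E = climb (n + m) x y p∈E (≤-trans (m≤m+n _ x) (m≤m+n _ y))
  where
  -- Each move right or up inside `E` raises the coordinate sum, which stays below `n + m`, so the
  -- fuel cannot run out. Where both moves leave `E`, down-closure makes the point maximal.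
  climb : ∀ fuel x y → points E (x , y) → n + m ≤ fuel + x + y → ∃ λ q → ConvexCorner E q × (x , y) ≼ q
  climb zero x y p∈E enough =
    contradiction enough (<⇒≱ (let x<n , y<m = E⊆R p∈E in +-mono-< x<n y<m))
  climb (suc fuel) x y p∈E enough with points? E (suc x , y) | points? E (x , suc y)
  ... | yes r∈E | _ =
    let q , q-corner , (x<q , y≤q) = climb fuel (suc x) y r∈E
          (subst (n + m ≤_) (cong (_+ y) (sym (+-suc fuel x))) enough)
    in q , q-corner , (<⇒≤ x<q , y≤q)
  ... | no _ | yes r∈E =
    let q , q-corner , (x≤q , y<q) = climb fuel x (suc y) r∈E
          (subst (n + m ≤_) (sym (+-suc (fuel + x) y)) enough)
    in q , q-corner , (x≤q , <⇒≤ y<q)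
  ... | no right∉E | no up∉E = (x , y) , (p∈E , maximal) , (≤-refl , ≤-refl)
    where
    maximal : ∀ {q} → points E q → (x , y) ≼ q → q ≡ (x , y)
    maximal q∈E (x≤ , y≤) = cong₂ _,_
      (≤-antisym (≮⇒≥ λ x< → right∉E (downClosed E (x< , y≤) q∈E)) x≤)
      (≤-antisym (≮⇒≥ λ y< → up∉E (downClosed E (x≤ , y<) q∈E)) y≤)

-- A bounded diagram is the down-closure of its convex corners.
convexCorners-determine-⊆ : ∀ E F → points E ⊆ points (R n m) →
  ConvexCorner E ⊆ ConvexCorner F → points E ⊆ points F
convexCorners-determine-⊆ E F E⊆R corners p∈E =
  let q , q-corner , p≼q = below-convexCorner E E⊆R p∈E in downClosed F p≼q (proj₁ (corners q-corner))

-- The only concave corner of the truncated diagram inside the grid is `(a , b)`, and its reflection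
-- is the top corner of the rectangle. If `a` reaches `n` or `b` reaches `m`, the rectangle is empty
-- and there are no corners on either side.
dual-V : ∀ m n a b → IsDual m n (V a b ⊓ R n m) (R (n ∸ a) (m ∸ b))
dual-V m n a b = proj₂ , (D⊆R , corners⊆ , corners⊇) , unique
  where
  Y = V a b ⊓ R n m
  D = R (n ∸ a) (m ∸ b)

  D⊆R : points D ⊆ points (R n m)
  D⊆R (x< , y<) = <-≤-trans x< (m∸n≤m n a) , <-≤-trans y< (m∸n≤m m b)

  ∉Y⇒above : ∀ {x y} → x < n → y < m → ¬ points Y (x , y) → a ≤ x × b ≤ y
  ∉Y⇒above {x} {y} x<n y<m ∉Y = decidable-stable (a ≤? x ×-dec b ≤? y) λ ∈V → ∉Y (∈V , x<n , y<m)

  corner-Y : a < n → b < m → ConcaveCorner Y (a , b)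
  corner-Y a<n b<m = (λ (∈V , _) → ∈V (≤-refl , ≤-refl)) , λ ∉Y (x≤a , y≤b) →
    let a≤x , b≤y = ∉Y⇒above (≤-<-trans x≤a a<n) (≤-<-trans y≤b b<m) ∉Y
    in cong₂ _,_ (≤-antisym x≤a a≤x) (≤-antisym y≤b b≤y)

  <⇒≤∸1 : ∀ {x k} → x < k → x ≤ k ∸ 1
  <⇒≤∸1 (s≤s x≤k) = x≤k

  ∸1< : ∀ {k} → 0 < k → k ∸ 1 < k
  ∸1< (s≤s _) = ≤-refl

  corners⊆ : ConvexCorner D ⊆ ReflectedConcaveCorner m n Y
  corners⊆ {x , y} ((x< , y<) , maximal) = a , b , corner-Y a<n b<m , a<n , b<m ,
    -- The reflected corner lies above every point of `D`, so a maximal point must equal it.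
    sym (maximal (∸1< (≤-<-trans z≤n x<) , ∸1< (≤-<-trans z≤n y<)) (<⇒≤∸1 x< , <⇒≤∸1 y<))
    where
    a<n : a < n
    a<n = m∸n≢0⇒n<m (m<n⇒n≢0 x<)
    b<m : b < m
    b<m = m∸n≢0⇒n<m (m<n⇒n≢0 y<)

  corners⊇ : ReflectedConcaveCorner m n Y ⊆ ConvexCorner D
  corners⊇ (a′ , b′ , (∉Y , minimal) , a′<n , b′<m , refl)
    with ∉Y⇒above a′<n b′<m ∉Y
  -- `(a , b)` is itself outside `Y` and below the given concave corner, so minimality identifies
  -- the two.
  ... | a≤a′ , b≤b′ with minimal {a , b} (λ (∈V , _) → ∈V (≤-refl , ≤-refl)) (a≤a′ , b≤b′)
  ... | refl = (∸1< (m<n⇒0<n∸m a′<n) , ∸1< (m<n⇒0<n∸m b′<m)) , λ (x< , y<) (≤x , ≤y) →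
    cong₂ _,_ (≤-antisym (<⇒≤∸1 x<) ≤x) (≤-antisym (<⇒≤∸1 y<) ≤y)

  unique : ∀ E → DualityConditions m n Y E → points E ≐ points D
  unique E (E⊆R , E⊆Y , Y⊆E) =
    convexCorners-determine-⊆ E D E⊆R (corners⊇ ∘ E⊆Y) , convexCorners-determine-⊆ D E D⊆R (Y⊆E ∘ corners⊆)

corollary3p3 : (m n a b : ℕ) → 1 ≤ m → 1 ≤ n → a ≤ n → b ≤ m →
    IsDual m n (V a b ⊓ R n m) (R (n ∸ a) (m ∸ b))
    × ex m n (singleStar a b) ≡ m * n ∸ γ (R (n ∸ a) (m ∸ b)) m n
    × (a ≤ n ∸ 1 → b ≤ m ∸ 1 →
    IsMinimum
    (λ k → ∃₂ λ x y → (m ∸ b ≤ x × x ≤ m) × (n ∸ a ≤ y × y ≤ n)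
    × k ≡ (m ∸ x) * (n ∸ y) + ((n ∸ a) * x ⊔ (m ∸ b) * y))
    (γ (R (n ∸ a) (m ∸ b)) m n))
corollary3p3 m n a b 1≤m 1≤n a≤n b≤m = dual-V m n a b , ex≡mn∸γ m n a b , λ a≤n∸1 b≤m∸1 →
  -- With `1 ≤ n` and `1 ≤ m`, the bounds by `n ∸ 1` and `m ∸ 1` are strict inequalities, so both
  -- thresholds `n ∸ a` and `m ∸ b` are positive.
  let instance
        _ = >-nonZero (m<n⇒0<n∸m (a<n 1≤n a≤n∸1))
        _ = >-nonZero (m<n⇒0<n∸m (a<n 1≤m b≤m∸1))
  in γ-formula (m∸n≤m n a) (m∸n≤m m b)
  where
  a<n : ∀ {a n} → 1 ≤ n → a ≤ n ∸ 1 → a < n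
  a<n (s≤s _) a≤n∸1 = s≤s a≤n∸1
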